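{- Let $n,p>1$ and $q\geq 1$ be integers. A magic column rectangle $MCR(n^{(p)};q)$ exists if and only if $n$ is even or all three of $n,p,q$ are odd.
   Context: A magic column rectangle $MCR(n^{(p)};q)$ is an $np\times q$ matrix whose entries are $1,2,\ldots,npq$, each appearing exactly once, which is partitioned into $pq$ blocks of size $n\times 1$ (each column is split into $p$ consecutive segments of $n$ entries) such that the sum of the entries in every block is the same constant (necessarily $\frac{n(npq+1)}{2}$). -}

module Defs where

open import Algebra.Properties.CommutativeMonoid.Sum using (sum)
open import Data.Fin using (Fin; combine)
open import Data.Nat using (ℕ; _*_; _≤_)
open import Data.Nat.Divisibility using (_∣_)
open import Data.Nat.Properties using (+-0-commutativeMonoid)
open import Data.Product using (∃; ∃!; _×_; _,_)
open import Relation.Binary.PropositionalEquality using (_≡_)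
open import Relation.Nullary using (¬_)

Even : ℕ → Set
Even m = 2 ∣ m

Odd : ℕ → Set
Odd m = ¬ Even m

Matrix : ℕ → ℕ → Set
Matrix r c = Fin r → Fin c → ℕ

-- The number of rows is written p * n so that combine : Fin p → Fin n → Fin (p * n)
-- addresses them: toℕ (combine b i) = n * toℕ b + toℕ i, so for fixed b the rows
-- combine b i are n consecutive rows.
blockSum : ∀ {n p q} → Matrix (p * n) q → Fin p → Fin q → ℕ
blockSum {n} M b c = sum +-0-commutativeMonoid {n} (λ i → M (combine b i) c)

record IsMagicColumnRectangle (n p q : ℕ) (M : Matrix (p * n) q) : Set where
  field
    entries-in-range   : ∀ r c → 1 ≤ M r c × M r c ≤ n * p * q
    each-appears-once  : ∀ k → 1 ≤ k → k ≤ n * p * q →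
                         ∃! _≡_ λ ((r , c) : Fin (p * n) × Fin q) → M r c ≡ k
    constant-block-sum : ∃ λ s → ∀ (b : Fin p) (c : Fin q) → blockSum {n} {p} {q} M b c ≡ s

MCR : (n p q : ℕ) → Set
MCR n p q = ∃ (IsMagicColumnRectangle n p q)

{-# OPTIONS --safe #-}

-- A rectangle amounts to a partition of {1,…,nN}, N = pq, into N blocks of size n with equal
-- sum s.  Adding everything up gives 2s = n(nN+1), so for odd n the product nN is odd.
-- Conversely, let block j take from the i-th run of N consecutive numbers the one at position
-- σᵢ(j), for permutations σᵢ of {0,…,N−1} whose pointwise sum Σᵢ σᵢ is constant.  The identity
-- and its reversal add up to a constant, which settles even n; for odd n and N = 2m+1 one
-- starts from three permutations: the identity, the rotation by m, and 3m minus their sum.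
module Submission where

open import Defs
open import Algebra.Properties.CommutativeMonoid.Sum using (sum)
open import Data.Fin using (Fin; zero; suc; toℕ; fromℕ<; combine; remQuot; splitAt; join; opposite; punchOut; _↑ˡ_; _↑ʳ_)
open import Data.Fin.Permutation using (Permutation; Permutation′; ↔⇒≡; reverse; _⟨$⟩ʳ_; _⟨$⟩ˡ_; inverseˡ; inverseʳ) renaming (id to idₚ)
open import Data.Fin.Properties using (toℕ-injective; toℕ<n; toℕ-fromℕ<; toℕ-↑ˡ; toℕ-↑ʳ; toℕ-combine; remQuot-combine; *↔×; +↔⊎; opposite-prop; opposite-involutive; punchOut-injective; injective⇒≤; any?; join-splitAt) renaming (_≟_ to _≟ᶠ_)
open import Data.Nat using (ℕ; zero; suc; pred; _+_; _*_; _<_; _≤_; z<s; s≤s; s≤s⁻¹; NonZero; >-nonZero)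
open import Data.Nat.Divisibility using (_∣_; divides; _∣?_; ∣m⇒∣m*n; ∣n⇒∣m*n; m∣m*n; ∣m+n∣m⇒∣n; ∣1⇒≡1; m%n≡0⇒n∣m)
open import Data.Nat.DivMod using (_/_; _%_; m≡m%n+[m/n]*n; m%n<n)
open import Data.Nat.Primality using (prime[2]; euclidsLemma)
open import Data.Nat.Properties
open import Data.Nat.Tactic.RingSolver using (solve-∀)
open import Data.Product using (∃; ∃!; _×_; _,_; proj₁; proj₂)
open import Data.Product.Function.NonDependent.Propositional using (_×-↔_)
open import Data.Sum using (_⊎_; inj₁; inj₂)
open import Data.Vec.Functional using (_∷_; [])
open import Function using (_∘_; _$_)
open import Function.Bundles using (_⇔_; _↔_; mk⇔; mk↔ₛ′; module Inverse; module Injection)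
open import Function.Construct.Composition using (_↔-∘_)
open import Function.Construct.Identity using (↔-id)
open import Function.Construct.Symmetry using (↔-sym)
open import Function.Definitions using (Injective)
open import Function.Properties.Inverse using (↔⇒↣)
open import Relation.Binary.PropositionalEquality using (_≡_; _≢_; refl; sym; trans; cong; cong₂; subst; module ≡-Reasoning)
open import Relation.Nullary using (yes; no; contradiction)

open Algebra.Properties.CommutativeMonoid.Sum +-0-commutativeMonoid using (∑-distrib-+; sum-cong-≗; sum-permute)

private
  variable
    n p q K N : ℕ

-- Finite sums and parity

∑ : (Fin n → ℕ) → ℕ
∑ = sum +-0-commutativeMonoid

∑-const : ∀ n (x : ℕ) → ∑ {n} (λ _ → x) ≡ n * x
∑-const zero    x = refl
∑-const (suc n) x = cong (x +_) (∑-const n x)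

∑-+ : ∀ m {n} (f : Fin (m + n) → ℕ) → ∑ f ≡ ∑ (λ i → f (i ↑ˡ n)) + ∑ (λ j → f (m ↑ʳ j))
∑-+ zero    f = refl
∑-+ (suc m) f = trans (cong (f zero +_) (∑-+ m (f ∘ suc))) (sym (+-assoc (f zero) _ _))

∑-combine : ∀ m {n} (f : Fin (m * n) → ℕ) → ∑ f ≡ ∑ {m} (λ i → ∑ {n} (λ j → f (combine i j)))
∑-combine zero        f = refl
∑-combine (suc m) {n} f = trans (∑-+ n f) (cong (∑ (λ j → f (j ↑ˡ (m * n))) +_) (∑-combine m (f ∘ (n ↑ʳ_))))

2*∑-suc∘toℕ : ∀ n → 2 * ∑ {n} (suc ∘ toℕ) ≡ n * suc n
2*∑-suc∘toℕ zero    = refl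
2*∑-suc∘toℕ (suc n) = begin
  2 * suc (∑ {n} (λ i → 1 + suc (toℕ i)))             ≡⟨ cong (λ s → 2 * suc s) (∑-distrib-+ {n} (λ _ → 1) (suc ∘ toℕ)) ⟩
  2 * suc (∑ {n} (λ _ → 1) + ∑ {n} (suc ∘ toℕ))       ≡⟨ cong (λ s → 2 * suc (s + ∑ {n} (suc ∘ toℕ))) (∑-const n 1) ⟩
  2 * suc (n * 1 + ∑ {n} (suc ∘ toℕ))                 ≡⟨ expand n (∑ {n} (suc ∘ toℕ)) ⟩
  2 + 2 * n + 2 * ∑ {n} (suc ∘ toℕ)                   ≡⟨ cong (2 + 2 * n +_) (2*∑-suc∘toℕ n) ⟩
  2 + 2 * n + n * suc n                               ≡⟨ collect n ⟩
  suc n * suc (suc n)                                 ∎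
  where
  open ≡-Reasoning
  expand : ∀ n s → 2 * suc (n * 1 + s) ≡ 2 + 2 * n + 2 * s
  expand = solve-∀
  collect : ∀ n → 2 + 2 * n + n * suc n ≡ suc n * suc (suc n)
  collect = solve-∀

odd⇒≡1+*2 : ∀ n → Odd n → ∃ λ k → n ≡ suc (k * 2)
odd⇒≡1+*2 n n-odd with n % 2 in eq | m≡m%n+[m/n]*n n 2 | m%n<n n 2
... | 0           | _  | _                = contradiction (m%n≡0⇒n∣m n 2 eq) n-odd
... | 1           | n≡ | _                = n / 2 , n≡
... | suc (suc _) | _  | s≤s (s≤s ())

even-suc⇒odd : ∀ n → Even (suc n) → Odd n
even-suc⇒odd n 2∣1+n 2∣n with () ← ∣1⇒≡1 (∣m+n∣m⇒∣n (subst (2 ∣_) (+-comm 1 n) 2∣1+n) 2∣n)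

*2≢1+*2 : ∀ a b → a * 2 ≢ suc (b * 2)
*2≢1+*2 a b eq = even-suc⇒odd (b * 2) (divides a (sym eq)) (divides b refl)

-- Partitions into equally sized blocks with equal sums

-- The bijection sends (block, position in the block) to an element. `K` is a separate parameter
-- because the products `n * p * q`, `n * N` and `N * n` agree only propositionally.
EqualSumPartition : (N n K : ℕ) → Set
EqualSumPartition N n K = ∃ λ (φ : (Fin N × Fin n) ↔ Fin K) →
  ∃ λ s → ∀ j → ∑ (λ i → suc (toℕ (Inverse.to φ (j , i)))) ≡ s

module _ {A : Set} where

  -- The set {1,…,K} is represented by Fin K through k ↦ 1 + k.
  Enumerates : (A → ℕ) → ℕ → Set
  Enumerates f K = (∀ a → 1 ≤ f a × f a ≤ K) ×
                   (∀ k → 1 ≤ k → k ≤ K → ∃! _≡_ λ a → f a ≡ k)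

  -- The preimage chosen by `∃!` is the inverse map: its existence half gives one composite, its
  -- uniqueness half the other.
  enumerates⇒↔ : ∀ {f} → Enumerates f K → ∃ λ (φ : A ↔ Fin K) → ∀ a → suc (toℕ (Inverse.to φ a)) ≡ f a
  enumerates⇒↔ {K} {f} (inRange , once) = mk↔ₛ′ to from to∘from from∘to , suc-to
    where
    pred-f<K : ∀ a → pred (f a) < K
    pred-f<K a with f a | inRange a
    ... | suc _ | _ , fa≤K = fa≤K

    to : A → Fin K
    to a = fromℕ< (pred-f<K a)

    suc-to : ∀ a → suc (toℕ (to a)) ≡ f a
    suc-to a = trans (cong suc (toℕ-fromℕ< (pred-f<K a))) (suc-pred (f a) {{>-nonZero (proj₁ (inRange a))}})

    preimage : (k : Fin K) → ∃! _≡_ λ a → f a ≡ suc (toℕ k)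
    preimage k = once (suc (toℕ k)) z<s (toℕ<n k)

    from : Fin K → A
    from = proj₁ ∘ preimage

    to∘from : ∀ k → to (from k) ≡ k
    to∘from k = toℕ-injective (suc-injective (trans (suc-to (from k)) (proj₁ (proj₂ (preimage k)))))

    from∘to : ∀ a → from (to a) ≡ a
    from∘to a = proj₂ (proj₂ (preimage (to a))) (sym (suc-to a))

  ↔⇒enumerates : (φ : A ↔ Fin K) → Enumerates (λ a → suc (toℕ (Inverse.to φ a))) K
  ↔⇒enumerates {K} φ = (λ a → z<s , toℕ<n (to a)) , once
    where
    open Inverse φ using (to; from; strictlyInverseˡ; strictlyInverseʳ)
    once : ∀ k → 1 ≤ k → k ≤ K → ∃! _≡_ λ a → suc (toℕ (to a)) ≡ k
    once (suc k) _ k<K = from (fromℕ< k<K)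
      , cong suc (trans (cong toℕ (strictlyInverseˡ (fromℕ< k<K))) (toℕ-fromℕ< k<K))
      , λ {a} eq → trans (cong from (toℕ-injective (trans (toℕ-fromℕ< k<K) (sym (suc-injective eq))))) (strictlyInverseʳ a)

-- Entry `i` of block `combine b c` lies in row `combine b i` and column `c`, so passing between the
-- two indexings exchanges `c` and `i`.
cells : ∀ n p q → (Fin (p * q) × Fin n) ↔ (Fin (p * n) × Fin q)
cells n p q = (↔-sym (*↔× {p}) ×-↔ ↔-id _) ↔-∘ (exchange ↔-∘ (*↔× {p} ×-↔ ↔-id _))
  where
  exchange : {A B C : Set} → ((A × B) × C) ↔ ((A × C) × B)
  exchange = mk↔ₛ′ (λ ((a , b) , c) → (a , c) , b) (λ ((a , c) , b) → (a , b) , c) (λ _ → refl) (λ _ → refl)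

MCR⇒partition : ∀ n p q → MCR n p q → EqualSumPartition (p * q) n (n * p * q)
MCR⇒partition n p q (M , isMCR) = ψ ↔-∘ cells n p q , s , λ j →
  trans (sum-cong-≗ {n} (λ i → suc-ψ (Inverse.to (cells n p q) (j , i)))) (block-const (remQuot q j))
  where
  open IsMagicColumnRectangle isMCR
  enumeration = enumerates⇒↔ {f = λ (r , c) → M r c} ((λ (r , c) → entries-in-range r c) , each-appears-once)
  ψ = proj₁ enumeration
  suc-ψ = proj₂ enumeration
  s = proj₁ constant-block-sum
  block-const : ∀ ((b , c) : Fin p × Fin q) → blockSum {n} {p} {q} M b c ≡ s
  block-const (b , c) = proj₂ constant-block-sum b c

partition⇒MCR : ∀ n p q → EqualSumPartition (p * q) n (n * p * q) → MCR n p q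
partition⇒MCR n p q (φ , s , constant) = M , record
  { entries-in-range   = λ r c → proj₁ enumerates (r , c)
  ; each-appears-once  = proj₂ enumerates
  ; constant-block-sum = s , λ b c → trans
      -- Row `combine b i` splits back into `b` and `i`, so the entries of a matrix block are those
      -- of one block of the partition.
      (sum-cong-≗ {n} (λ i → cong (λ (b′ , i′) → suc (toℕ (Inverse.to φ (combine b′ c , i′)))) (remQuot-combine b i)))
      (constant (combine b c))
  }
  where
  ψ : (Fin (p * n) × Fin q) ↔ Fin (n * p * q)
  ψ = φ ↔-∘ ↔-sym (cells n p q)
  enumerates = ↔⇒enumerates ψ
  M : Matrix (p * n) q
  M r c = suc (toℕ (Inverse.to ψ (r , c)))

-- Double counting: twice the total of all elements is `K * suc K` directly and `2 * (N * s)` block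
-- by block; the nonzero factor `N` cancels.
partition⇒2*s : .{{NonZero N}} → ((φ , s , _) : EqualSumPartition N n K) → 2 * s ≡ n * suc (N * n)
partition⇒2*s {N} {n} {K} (φ , s , constant) = *-cancelˡ-≡ _ _ N $ begin
  N * (2 * s)                         ≡⟨ swap-2 N s ⟩
  2 * (N * s)                         ≡⟨ cong (2 *_) total ⟨
  2 * ∑ {K} (suc ∘ toℕ)               ≡⟨ 2*∑-suc∘toℕ K ⟩
  K * suc K                           ≡⟨ cong (λ K → K * suc K) (↔⇒≡ π) ⟨
  N * n * suc (N * n)                 ≡⟨ *-assoc N n _ ⟩
  N * (n * suc (N * n))               ∎
  where
  open ≡-Reasoning
  swap-2 : ∀ a b → a * (2 * b) ≡ 2 * (a * b)
  swap-2 = solve-∀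
  π : Permutation (N * n) K
  π = φ ↔-∘ *↔× {N}
  value : Fin N × Fin n → ℕ
  value x = suc (toℕ (Inverse.to φ x))
  total : ∑ {K} (suc ∘ toℕ) ≡ N * s
  total = begin
    ∑ {K} (suc ∘ toℕ)                                           ≡⟨ sum-permute (suc ∘ toℕ) π ⟩
    ∑ {N * n} (value ∘ remQuot n)                               ≡⟨ ∑-combine N (value ∘ remQuot n) ⟩
    ∑ {N} (λ j → ∑ {n} (λ i → value (remQuot n (combine j i)))) ≡⟨ sum-cong-≗ {N} (λ j → sum-cong-≗ {n} (λ i → cong value (remQuot-combine j i))) ⟩
    ∑ {N} (λ j → ∑ {n} (λ i → value (j , i)))                   ≡⟨ sum-cong-≗ {N} constant ⟩
    ∑ {N} (λ _ → s)                                             ≡⟨ ∑-const N s ⟩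
    N * s                                                       ∎

-- Since 2 divides `n * suc (N * n)` but not `n`, it divides `suc (N * n)`; then `N * n` is odd, and
-- so is its factor `N`.
partition⇒odd : .{{NonZero N}} → Odd n → EqualSumPartition N n K → Odd N
partition⇒odd {N} {n} n-odd P@(_ , s , _)
  with euclidsLemma n (suc (N * n)) prime[2] (subst (2 ∣_) (partition⇒2*s P) (m∣m*n s))
... | inj₁ 2∣n    = contradiction 2∣n n-odd
... | inj₂ 2∣1+Nn = even-suc⇒odd (N * n) 2∣1+Nn ∘ ∣m⇒∣m*n n

-- Permutations with constant pointwise sum

Balanced : (n N : ℕ) → Set
Balanced n N = ∃ λ (σ : Fin n → Permutation′ N) → ∃ λ t → ∀ j → ∑ (λ i → toℕ (σ i ⟨$⟩ʳ j)) ≡ t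

-- Block `j` receives `N * i + σᵢ(j)` from run `i`. The part `N * i` does not depend on `j`, and the
-- remainders have constant sum because `σ` is balanced.
balanced⇒partition : ∀ n N → Balanced n N → EqualSumPartition N n (n * N)
balanced⇒partition n N (σ , t , constant) = ↔-sym (*↔× {n}) ↔-∘ permuteRows , _ , λ j → begin
  ∑ (λ i → suc (toℕ (combine i (σ i ⟨$⟩ʳ j))))                     ≡⟨ sum-cong-≗ {n} (λ i → cong suc (toℕ-combine i (σ i ⟨$⟩ʳ j))) ⟩
  ∑ (λ i → suc (N * toℕ i) + toℕ (σ i ⟨$⟩ʳ j))                     ≡⟨ ∑-distrib-+ {n} (λ i → suc (N * toℕ i)) (λ i → toℕ (σ i ⟨$⟩ʳ j)) ⟩
  ∑ {n} (λ i → suc (N * toℕ i)) + ∑ (λ i → toℕ (σ i ⟨$⟩ʳ j))       ≡⟨ cong (∑ {n} (λ i → suc (N * toℕ i)) +_) (constant j) ⟩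
  ∑ {n} (λ i → suc (N * toℕ i)) + t                                ∎
  where
  open ≡-Reasoning
  permuteRows : (Fin N × Fin n) ↔ (Fin n × Fin N)
  permuteRows = mk↔ₛ′ (λ (j , i) → i , σ i ⟨$⟩ʳ j) (λ (i , j) → σ i ⟨$⟩ˡ j , i)
    (λ (i , j) → cong (i ,_) (inverseʳ (σ i))) (λ (j , i) → cong (_, i) (inverseˡ (σ i)))

toℕ+toℕ-opposite : (i : Fin n) → suc (toℕ i) + toℕ (opposite i) ≡ n
toℕ+toℕ-opposite i = trans (cong (suc (toℕ i) +_) (opposite-prop i)) (m+[n∸m]≡n (toℕ<n i))

opposite-injective : Injective _≡_ _≡_ (opposite {n})
opposite-injective {x = i} {j} eq = trans (sym (opposite-involutive i)) (trans (cong opposite eq) (opposite-involutive j))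

balanced-0 : Balanced 0 N
balanced-0 = (λ ()) , 0 , λ _ → refl

-- At every position the identity and the reversal together contribute `N - 1`, written `pred N`.
balanced-2+ : Balanced n N → Balanced (2 + n) N
balanced-2+ {n} {N} (σ , t , constant) = (idₚ ∷ reverse ∷ σ) , pred N + t , λ j →
  trans (sym (+-assoc (toℕ j) _ _)) (cong₂ _+_ (cong pred (toℕ+toℕ-opposite j)) (constant j))

balanced-*2+ : ∀ k → Balanced n N → Balanced (k * 2 + n) N
balanced-*2+ zero    B = B
balanced-*2+ (suc k) B = balanced-2+ (balanced-*2+ k B)

-- Pigeonhole: if `y` were missed, punching it out of the codomain would inject `Fin (suc n)` into
-- `Fin n`.
injective⇒surjective : (f : Fin n → Fin n) → Injective _≡_ _≡_ f → ∀ y → ∃ λ x → f x ≡ y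
injective⇒surjective {suc n} f f-inj y with any? (λ x → f x ≟ᶠ y)
... | yes found = found
... | no  none  = contradiction (injective⇒≤ punched-inj) 1+n≰n
  where
  y≢f : ∀ x → y ≢ f x
  y≢f x eq = none (x , sym eq)
  punched-inj : Injective _≡_ _≡_ (λ x → punchOut (y≢f x))
  punched-inj {x} {x′} eq = f-inj (punchOut-injective (y≢f x) (y≢f x′) eq)

-- Lets a permutation be given by a numerical formula alone, with the inverse supplied by
-- finiteness.
injective⇒permutation : (g : Fin n → ℕ) → (∀ i → g i < n) → Injective _≡_ _≡_ g →
                        ∃ λ (π : Permutation′ n) → ∀ i → toℕ (π ⟨$⟩ʳ i) ≡ g i
injective⇒permutation {n} g g< g-inj =
  mk↔ₛ′ f (proj₁ ∘ f-surj) (proj₂ ∘ f-surj) (λ i → f-inj (proj₂ (f-surj (f i)))) , toℕ-f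
  where
  f : Fin n → Fin n
  f i = fromℕ< (g< i)
  toℕ-f : ∀ i → toℕ (f i) ≡ g i
  toℕ-f i = toℕ-fromℕ< (g< i)
  f-inj : Injective _≡_ _≡_ f
  f-inj {i} {j} eq = g-inj (trans (sym (toℕ-f i)) (trans (cong toℕ eq) (toℕ-f j)))
  f-surj = injective⇒surjective f f-inj

-- Three balanced permutations of 2m+1 positions

module ThreeRows (m : ℕ) where

  Split : Set
  Split = Fin (suc m) ⊎ Fin m

  -- Addition of `m` modulo 2m+1: the first m+1 positions move up by `m`, the last `m` wrap around
  -- to the start.
  rotate : Split → ℕ
  rotate (inj₁ a) = m + toℕ a
  rotate (inj₂ b) = toℕ b

  -- 3m minus the position minus its rotation: the even numbers downwards, then the odd ones.
  complement : Split → ℕ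
  complement (inj₁ a) = toℕ (opposite a) * 2
  complement (inj₂ b) = suc (toℕ (opposite b) * 2)

  rotate-< : ∀ x → rotate x < suc m + m
  rotate-< (inj₁ a) = s≤s (+-monoʳ-≤ m (s≤s⁻¹ (toℕ<n a)))
  rotate-< (inj₂ b) = m≤n⇒m≤o+n (suc m) (toℕ<n b)

  rotate-injective : Injective _≡_ _≡_ rotate
  rotate-injective {inj₁ a} {inj₁ a′} eq = cong inj₁ (toℕ-injective (+-cancelˡ-≡ m _ _ eq))
  rotate-injective {inj₂ b} {inj₂ b′} eq = cong inj₂ (toℕ-injective eq)
  -- The two halves cannot collide: the first has values at least `m`, the second values below `m`.
  rotate-injective {inj₁ a} {inj₂ b}  eq = contradiction (subst (_< m) (sym eq) (toℕ<n b)) (m+n≮m m (toℕ a))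
  rotate-injective {inj₂ b} {inj₁ a}  eq = contradiction (subst (_< m) eq (toℕ<n b)) (m+n≮m m (toℕ a))

  complement-< : ∀ x → complement x < suc m + m
  complement-< x = s≤s (subst (complement x ≤_) (n*2≡n+n m) (bound x))
    where
    n*2≡n+n : ∀ n → n * 2 ≡ n + n
    n*2≡n+n = solve-∀
    bound : ∀ x → complement x ≤ m * 2
    bound (inj₁ a) = *-monoˡ-≤ 2 (s≤s⁻¹ (toℕ<n (opposite a)))
    bound (inj₂ b) = ≤-trans (n≤1+n _) (*-monoˡ-≤ 2 (toℕ<n (opposite b)))

  complement-injective : Injective _≡_ _≡_ complement
  complement-injective {inj₁ a} {inj₁ a′} eq = cong inj₁ (opposite-injective (toℕ-injective (*-cancelʳ-≡ _ _ 2 eq)))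
  complement-injective {inj₂ b} {inj₂ b′} eq = cong inj₂ (opposite-injective (toℕ-injective (*-cancelʳ-≡ _ _ 2 (suc-injective eq))))
  -- Here the two halves are kept apart by parity.
  complement-injective {inj₁ a} {inj₂ b}  eq = contradiction eq (*2≢1+*2 (toℕ (opposite a)) (toℕ (opposite b)))
  complement-injective {inj₂ b} {inj₁ a}  eq = contradiction (sym eq) (*2≢1+*2 (toℕ (opposite a)) (toℕ (opposite b)))

  splitAt-injective : Injective _≡_ _≡_ (splitAt (suc m) {m})
  splitAt-injective = Injection.injective (↔⇒↣ (+↔⊎ {suc m} {m}))

  rotation : ∃ λ (π : Permutation′ (suc m + m)) → ∀ j → toℕ (π ⟨$⟩ʳ j) ≡ rotate (splitAt (suc m) j)
  rotation = injective⇒permutation _ (rotate-< ∘ splitAt (suc m)) (splitAt-injective ∘ rotate-injective)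

  complementation : ∃ λ (π : Permutation′ (suc m + m)) → ∀ j → toℕ (π ⟨$⟩ʳ j) ≡ complement (splitAt (suc m) j)
  complementation = injective⇒permutation _ (complement-< ∘ splitAt (suc m)) (splitAt-injective ∘ complement-injective)

  -- In the first half a + (m+a) + 2(m-a) = 3m; in the second (m+1+b) + b + (2(m-1-b)+1) = 3m.
  rows-sum : ∀ x → toℕ (join (suc m) m x) + (rotate x + complement x) ≡ 3 * m
  rows-sum (inj₁ a) = begin
    toℕ (a ↑ˡ m) + (m + toℕ a + toℕ (opposite a) * 2)             ≡⟨ cong (_+ (m + toℕ a + toℕ (opposite a) * 2)) (toℕ-↑ˡ a m) ⟩
    toℕ a + (m + toℕ a + toℕ (opposite a) * 2)                    ≡⟨ collect (toℕ a) (toℕ (opposite a)) m ⟩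
    m + 2 * (toℕ a + toℕ (opposite a))                            ≡⟨ cong (λ k → m + 2 * k) (suc-injective (toℕ+toℕ-opposite a)) ⟩
    3 * m                                                         ∎
    where
    open ≡-Reasoning
    collect : ∀ a o m → a + (m + a + o * 2) ≡ m + 2 * (a + o)
    collect = solve-∀
  rows-sum (inj₂ b) = begin
    toℕ (suc m ↑ʳ b) + (toℕ b + suc (toℕ (opposite b) * 2))       ≡⟨ cong (_+ (toℕ b + suc (toℕ (opposite b) * 2))) (toℕ-↑ʳ (suc m) b) ⟩
    suc m + toℕ b + (toℕ b + suc (toℕ (opposite b) * 2))          ≡⟨ collect (toℕ b) (toℕ (opposite b)) m ⟩
    m + 2 * (suc (toℕ b) + toℕ (opposite b))                      ≡⟨ cong (λ k → m + 2 * k) (toℕ+toℕ-opposite b) ⟩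
    3 * m                                                         ∎
    where
    open ≡-Reasoning
    collect : ∀ b o m → suc m + b + (b + suc (o * 2)) ≡ m + 2 * (suc b + o)
    collect = solve-∀

  balanced-3 : Balanced 3 (suc m + m)
  balanced-3 = (idₚ ∷ proj₁ rotation ∷ proj₁ complementation ∷ []) , 3 * m , λ j →
    trans (cong₂ _+_ (sym (cong toℕ (join-splitAt (suc m) m j)))
                     -- The sum over three rows ends in `+ 0`, which `+-identityʳ` removes.
                     (cong₂ _+_ (proj₂ rotation j) (trans (+-identityʳ _) (proj₂ complementation j))))
          (rows-sum (splitAt (suc m) j))

-- Parity cases and the equivalence

even⇒balanced : Even n → Balanced n N
even⇒balanced {N = N} (divides k refl) = subst (λ n → Balanced n N) (+-identityʳ (k * 2)) (balanced-*2+ k balanced-0)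

odd⇒balanced : 1 < n → Odd n → Odd N → Balanced n N
odd⇒balanced {n} {N} 1<n n-odd N-odd with odd⇒≡1+*2 n n-odd | odd⇒≡1+*2 N N-odd
-- The case `n = 1` is excluded by `1 < n`; any larger odd `n` is three rows plus `k` pairs.
... | zero  , refl | _        = contradiction 1<n (<-irrefl refl)
... | suc k , refl | m , refl = subst (λ n → Balanced n N) (+-comm (k * 2) 3)
  (balanced-*2+ k (subst (Balanced 3) (odd-shape m) (ThreeRows.balanced-3 m)))
  where
  odd-shape : ∀ m → suc m + m ≡ suc (m * 2)
  odd-shape = solve-∀

balanced⇒MCR : ∀ n p q → Balanced n (p * q) → MCR n p q
balanced⇒MCR n p q B = partition⇒MCR n p q
  (subst (EqualSumPartition (p * q) n) (sym (*-assoc n p q)) (balanced⇒partition n (p * q) B))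

odd*odd : Odd p → Odd q → Odd (p * q)
odd*odd {p} {q} p-odd q-odd 2∣pq with euclidsLemma p q prime[2] 2∣pq
... | inj₁ 2∣p = p-odd 2∣p
... | inj₂ 2∣q = q-odd 2∣q

theorem9 : (n p q : ℕ) → 1 < n → 1 < p → 1 ≤ q →
    MCR n p q ⇔ (Even n ⊎ (Odd n × Odd p × Odd q))
theorem9 n p q 1<n 1<p 1≤q = mk⇔ necessary sufficient
  where
  instance
    pq≢0 : NonZero (p * q)
    pq≢0 = m*n≢0 p q {{>-nonZero (<⇒≤ 1<p)}} {{>-nonZero 1≤q}}

  necessary : MCR n p q → Even n ⊎ (Odd n × Odd p × Odd q)
  necessary R with 2 ∣? n
  ... | yes n-even = inj₁ n-even
  -- An even `p` or `q` would make `p * q`, the number of blocks, even.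
  ... | no  n-odd  = inj₂ (n-odd , pq-odd ∘ ∣m⇒∣m*n q , pq-odd ∘ ∣n⇒∣m*n p)
    where pq-odd = partition⇒odd n-odd (MCR⇒partition n p q R)

  sufficient : Even n ⊎ (Odd n × Odd p × Odd q) → MCR n p q
  sufficient (inj₁ n-even)                  = balanced⇒MCR n p q (even⇒balanced n-even)
  sufficient (inj₂ (n-odd , p-odd , q-odd)) = balanced⇒MCR n p q (odd⇒balanced 1<n n-odd (odd*odd p-odd q-odd))
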